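{- Let $n=2r+1\ge 7$. If a simple $n$-vertex hypergraph contains a Hamiltonian Berge cycle $C$ whose hyperedges all have size at least $r$, and an additional hyperedge $f\notin E(C)$ of size at least $r$, then the hyperedges in $E(C)\cup\{f\}$ form a Berge-pancyclic hypergraph (on the same vertex set). In particular, for every odd $n\ge 7$ and $r=(n-1)/2$, every simple $n$-vertex $r$-uniform hypergraph that contains a Hamiltonian Berge cycle $C$ and at least one edge outside $E(C)$ is Berge-pancyclic.
   Context: All hypergraphs are finite and simple: the edge family consists of distinct subsets of the vertex set. A Berge cycle of length $\ell\ge 2$ is an alternating sequence $x_0h_0x_1h_1\cdots x_{\ell-1}h_{\ell-1}x_0$ with distinct vertices $x_i$, distinct hyperedges $h_i$, and $\{x_i,x_{i+1}\}\subseteq h_i$ for every $i$ (indices modulo $\ell$); its edge set is $E(C)=\{h_0,\dots,h_{\ell-1}\}$. It is Hamiltonian if it contains every vertex. An $n$-vertex hypergraph is Berge-pancyclic if it contains Berge cycles of every length $2,3,\dots,n$. -}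

module Defs where

open import Data.Nat using (ℕ; suc; _≤_)
open import Data.Nat.DivMod using (_mod_)
open import Data.Fin using (Fin; toℕ)
open import Data.Fin.Properties using (nonZeroIndex)
open import Data.Fin.Subset using (Subset; ∣_∣) renaming (_∈_ to _∈ᵥ_)
open import Data.List using (List; _∷_; tabulate)
open import Data.List.Membership.Propositional using (_∈_; _∉_)
open import Data.List.Relation.Unary.All.Properties using (¬Any⇒All¬)
open import Data.List.Relation.Unary.AllPairs using (_∷_)
open import Data.List.Relation.Unary.Unique.Propositional using (Unique)
open import Data.List.Relation.Unary.Unique.Propositional.Properties using (tabulate⁺)
open import Data.Product using (∃)
open import Function.Definitions using (Injective)
open import Relation.Binary.PropositionalEquality using (_≡_)

-- The finite edge set is an enumeration without repetition; its order is
-- irrelevant, since edges are only ever accessed through membership.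
record Hypergraph (n : ℕ) : Set where
  field
    edges  : List (Subset n)
    simple : Unique edges

open Hypergraph public

-- i + 1 modulo ℓ
next : {ℓ : ℕ} → Fin ℓ → Fin ℓ
next {ℓ} i = (suc (toℕ i) mod ℓ) {{nonZeroIndex i}}

record BergeCycle {n : ℕ} (H : Hypergraph n) (ℓ : ℕ) : Set where
  field
    length≥2         : 2 ≤ ℓ
    vertex           : Fin ℓ → Fin n
    edge             : Fin ℓ → Subset n
    vertex-injective : Injective _≡_ _≡_ vertex
    edge-injective   : Injective _≡_ _≡_ edge
    edge∈H           : ∀ i → edge i ∈ edges H
    vertex∈edge      : ∀ i → vertex i ∈ᵥ edge i
    next∈edge        : ∀ i → vertex (next i) ∈ᵥ edge i

module _ {n ℓ : ℕ} {H : Hypergraph n} (C : BergeCycle H ℓ) where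
  open BergeCycle C

  edgeSet : List (Subset n)
  edgeSet = tabulate edge

  Hamiltonian : Set
  Hamiltonian = ∀ (v : Fin n) → ∃ λ i → vertex i ≡ v

  -- The hypergraph on the same vertex set with edge set E(C) ∪ {f}.
  cyclePlusEdge : (f : Subset n) → f ∉ edgeSet → Hypergraph n
  cyclePlusEdge f f∉C = record
    { edges  = f ∷ edgeSet
    ; simple = ¬Any⇒All¬ edgeSet f∉C ∷ tabulate⁺ edge-injective
    }

BergePancyclic : {n : ℕ} → Hypergraph n → Set
BergePancyclic {n} H = ∀ ℓ → 2 ≤ ℓ → ℓ ≤ n → BergeCycle H ℓ

Uniform : {n : ℕ} → ℕ → Hypergraph n → Set
Uniform r H = ∀ e → e ∈ edges H → ∣ e ∣ ≡ r

{-# OPTIONS --safe #-}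
module Submission where

-- Label the Hamiltonian cycle by ℤ/n with n = 2r + 1, and for a length ℓ strictly
-- between 2 and n put m = ℓ − 1. If the spare edge f contains two vertices at
-- distance m along the cycle, then f and the m cycle edges between them form a
-- Berge cycle of length ℓ. Otherwise f and f + m are disjoint, and by size they
-- cover all but one position z: membership in f alternates along the orbit of m
-- outside z, and as n is odd this orbit is everything. Hence m is a unit, f is
-- determined by z, and f contains two consecutive positions z + c, z + c + 1 with c
-- depending only on m. So f can take the place of the cycle edge at z + c, which
-- becomes the new spare edge. This settles position z + c for good, and a settled
-- position is never chosen again, since there the cycle edge would equal the spare
-- one. Repeating this n + 1 times is impossible.
--
-- For ℓ = 2, if no two of the n + 1 edges shared two vertices, every vertex would have
-- degree at most 3, and (n + 1) r ≤ 3n fails for r ≥ 3.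

open import Defs
open import Data.Bool using (Bool; true; false; not; if_then_else_)
open import Data.Bool.Properties using (not-involutive; not-¬) renaming (_≟_ to _≟ᵇ_)
open import Data.Empty using (⊥)
open import Data.Fin as Fin using (Fin; zero; suc; toℕ)
open import Data.Fin.Permutation using (Permutation; permutation)
open import Data.Fin.Properties
  using (any?; toℕ<n; toℕ-fromℕ<; toℕ-injective; injective⇒≤; punchInᵢ≢i)
open import Data.Fin.Subset using (Subset; ∣_∣; inside; outside) renaming (_∈_ to _∈ᵥ_)
open import Data.Fin.Subset.Properties using () renaming (_∈?_ to _∈ᵥ?_)
open import Data.List.Membership.Propositional using (_∈_; _∉_)
open import Data.List.Membership.Propositional.Properties using (∈-tabulate⁺)
open import Data.List.Relation.Unary.Any using (here; there)
open import Data.Nat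
  using (ℕ; zero; suc; 2+; _+_; _*_; _∸_; _≤_; _<_; z≤n; s≤s; _≟_; _≤?_; _<?_)
open import Data.Nat.DivMod
  using (_%_; _mod_; m%n<n; m%n%n≡m%n; m<n⇒m%n≡m; n%n≡0; [m+kn]%n≡m%n; %-distribˡ-+)
open import Data.Nat.Properties
open import Data.Nat.Tactic.RingSolver using (solve-∀)
open import Data.Product using (∃; ∃-syntax; _×_; _,_; proj₁; proj₂)
open import Data.Sum using (_⊎_; inj₁; inj₂)
open import Data.Vec using ([]; _∷_; lookup)
open import Data.Vec.Functional as F using (updateAt)
open import Data.Vec.Functional.Properties using (updateAt-updates; updateAt-minimal)
open import Data.Vec.Properties using (lookup⇒[]=; tabulate∘lookup; tabulate-cong)
open import Function using (_∘_; const)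
open import Function.Definitions using (Injective)
open import Relation.Binary.Bundles using (Setoid)
open import Relation.Binary.PropositionalEquality
  using (_≡_; _≢_; refl; sym; trans; cong; cong₂; subst)
open import Relation.Nullary using (¬_; Dec; yes; no; contradiction; ¬?; _×-dec_)
open import Algebra.Properties.CommutativeMonoid.Sum +-0-commutativeMonoid
  using (sum; sum-syntax; sum-cong-≗; ∑-distrib-+; ∑-comm; sum-permute; sum-remove)
open import Algebra.Properties.Semiring.Sum +-*-semiring using (*-distribˡ-sum)

-- Sums of small values, parity and alternation.

χ : Bool → ℕ
χ b = if b then 1 else 0

χ≤1 : ∀ b → χ b ≤ 1
χ≤1 true  = ≤-refl
χ≤1 false = z≤n

sum-mono : ∀ {k} {f g : Fin k → ℕ} → (∀ i → f i ≤ g i) → sum f ≤ sum g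
sum-mono {zero}  f≤g = z≤n
sum-mono {suc k} f≤g = +-mono-≤ (f≤g zero) (sum-mono (f≤g ∘ suc))

sum-const : ∀ k c → sum {k} (λ _ → c) ≡ k * c
sum-const zero    c = refl
sum-const (suc k) c = cong (c +_) (sum-const k c)

sum-≤-length : ∀ {k} {f : Fin k → ℕ} → (∀ i → f i ≤ 1) → sum f ≤ k
sum-≤-length {k} f≤1 =
  ≤-trans (sum-mono f≤1) (≤-reflexive (trans (sum-const k 1) (*-identityʳ k)))

-- The total falls short of its maximum by exactly one. Induction stops at the first zero, where the
-- remaining values already sum to their number, so `full` makes each of them 1.
unique-gap : ∀ {k} (g : Fin k → ℕ) → (∀ i → g i ≤ 1) → suc (sum g) ≡ k →
             ∃[ z ] (g z ≡ 0 × (∀ i → i ≢ z → g i ≡ 1))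
unique-gap {suc k} g g≤1 eq with g zero in g₀ | g≤1 zero
... | 0 | _ = zero , g₀ , λ
  { zero    0≢0 → contradiction refl 0≢0
  ; (suc i) _   → full (g ∘ suc) (g≤1 ∘ suc) (suc-injective eq) i }
  where
  full : ∀ {k} (g : Fin k → ℕ) → (∀ i → g i ≤ 1) → sum g ≡ k → ∀ i → g i ≡ 1
  full {suc k} g g≤1 eq with g zero in g₀ | g≤1 zero
  ... | 1 | _ = λ { zero → g₀ ; (suc i) → full (g ∘ suc) (g≤1 ∘ suc) (suc-injective eq) i }
  ... | 2+ _ | s≤s ()
  ... | 0 | _ = contradiction
    (≤-trans (≤-reflexive (sym eq)) (sum-≤-length (g≤1 ∘ suc))) 1+n≰n
... | 1 | _ with z , gz , others ← unique-gap (g ∘ suc) (g≤1 ∘ suc) (suc-injective eq) =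
  suc z , gz , λ
  { zero    _   → g₀
  ; (suc i) i≢z → others i (i≢z ∘ cong suc) }
... | 2+ _ | s≤s ()

even⊎odd : ∀ j → ∃[ a ] (j ≡ a + a ⊎ j ≡ suc (a + a))
even⊎odd zero = 0 , inj₁ refl
even⊎odd (suc j) with even⊎odd j
... | a , inj₁ refl = a , inj₂ refl
... | a , inj₂ refl = suc a , inj₁ (cong suc (sym (+-suc a a)))

double≢odd : ∀ a b → a + a ≢ suc (b + b)
double≢odd zero    b       ()
double≢odd (suc a) zero    eq rewrite +-suc a a = contradiction eq λ ()
double≢odd (suc a) (suc b) eq rewrite +-suc a a | +-suc b b =
  double≢odd a b (suc-injective (suc-injective eq))

halve-≤ : ∀ {a b} → a + a ≤ b + b → a ≤ b
halve-≤ {a} {b} le with a ≤? b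
... | yes a≤b = a≤b
... | no a≰b = contradiction le (<⇒≱ (+-mono-< (≰⇒> a≰b) (≰⇒> a≰b)))

halve-≤-odd : ∀ {a b} → a + a ≤ suc (b + b) → a ≤ b
halve-≤-odd {a} {b} le with a + a ≤? b + b
... | yes p = halve-≤ p
... | no p = contradiction (≤-antisym le (≰⇒> p)) (double≢odd a b)

toggle : ℕ → Bool → Bool
toggle zero    b = b
toggle (suc j) b = not (toggle j b)

toggle-double : ∀ a b → toggle (a + a) b ≡ b
toggle-double zero    b = refl
toggle-double (suc a) b rewrite +-suc a a = trans (not-involutive _) (toggle-double a b)

-- Arithmetic modulo the odd number `n`.

module Cyclic (r : ℕ) where

  n : ℕ
  n = suc (r + r)

  infix 4 _≈_
  -- Wrapping the equation of remainders in a record lets `a` and `b` be inferred from the type,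
  -- which the bare equation would not allow.
  record _≈_ (a b : ℕ) : Set where
    constructor mod≡
    field remainders : a % n ≡ b % n
  open _≈_ public

  ≈-setoid : Setoid _ _
  ≈-setoid = record
    { Carrier = ℕ ; _≈_ = _≈_
    ; isEquivalence = record
      { refl  = mod≡ refl
      ; sym   = λ p → mod≡ (sym (remainders p))
      ; trans = λ p q → mod≡ (trans (remainders p) (remainders q)) } }

  open Setoid ≈-setoid public using ()
    renaming (refl to ≈-refl; sym to ≈-sym; trans to ≈-trans; reflexive to ≈-reflexive)
  open import Relation.Binary.Reasoning.Setoid ≈-setoid

  _≈?_ : ∀ a b → Dec (a ≈ b)
  a ≈? b with a % n ≟ b % n
  ... | yes p = yes (mod≡ p)
  ... | no ¬p = no (¬p ∘ remainders)

  +-cong : ∀ {a b c d} → a ≈ b → c ≈ d → a + c ≈ b + d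
  +-cong {a} {b} {c} {d} (mod≡ p) (mod≡ q) = mod≡ (trans (%-distribˡ-+ a c n)
    (trans (cong₂ (λ x y → (x + y) % n) p q) (sym (%-distribˡ-+ b d n))))

  *-congˡ : ∀ c {a b} → a ≈ b → c * a ≈ c * b
  *-congˡ zero    p = ≈-refl
  *-congˡ (suc c) p = +-cong p (*-congˡ c p)

  +n*≈ : ∀ a k → a + k * n ≈ a
  +n*≈ a k = mod≡ ([m+kn]%n≡m%n a k n)

  n*≈0 : ∀ k → n * k ≈ 0
  n*≈0 k = ≈-trans (≈-reflexive (*-comm n k)) (+n*≈ 0 k)

  %≈ : ∀ a → a % n ≈ a
  %≈ a = mod≡ (m%n%n≡m%n a n)

  ≈⇒≡ : ∀ {a b} → a < n → b < n → a ≈ b → a ≡ b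
  ≈⇒≡ a<n b<n (mod≡ p) = trans (sym (m<n⇒m%n≡m a<n)) (trans p (m<n⇒m%n≡m b<n))

  -- Since `r + r` represents -1 modulo `n`, adding `k * (r + r)` undoes the addition of `k` without
  -- subtraction.
  +-cancelˡ : ∀ k {a b} → k + a ≈ k + b → a ≈ b
  +-cancelˡ k {a} {b} p = begin
    a                     ≈⟨ +n*≈ a k ⟨
    a + k * n             ≡⟨ rearr a k (r + r) ⟩
    k * (r + r) + (k + a) ≈⟨ +-cong (≈-refl {k * (r + r)}) p ⟩
    k * (r + r) + (k + b) ≡⟨ rearr b k (r + r) ⟨
    b + k * n             ≈⟨ +n*≈ b k ⟩
    b                     ∎
    where
    rearr : ∀ a k N → a + k * suc N ≡ k * N + (k + a)
    rearr = solve-∀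

  +-cancelʳ : ∀ k {a b} → a + k ≈ b + k → a ≈ b
  +-cancelʳ k {a} {b} p =
    +-cancelˡ k (≈-trans (≈-reflexive (+-comm k a)) (≈-trans p (≈-reflexive (+-comm b k))))

  toℕ-mod : ∀ a → toℕ (a mod n) ≈ a
  toℕ-mod a = ≈-trans (≈-reflexive (toℕ-fromℕ< (m%n<n a n))) (%≈ a)

  mod-cong : ∀ {a b} → a ≈ b → a mod n ≡ b mod n
  mod-cong {a} {b} (mod≡ p) = toℕ-injective
    (trans (toℕ-fromℕ< (m%n<n a n)) (trans p (sym (toℕ-fromℕ< (m%n<n b n)))))

  toℕ-≈-injective : ∀ {i j : Fin n} → toℕ i ≈ toℕ j → i ≡ j
  toℕ-≈-injective {i} {j} p = toℕ-injective (≈⇒≡ (toℕ<n i) (toℕ<n j) p)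

  mod-injective : ∀ {a b} → a mod n ≡ b mod n → a ≈ b
  mod-injective {a} {b} p =
    ≈-trans (≈-sym (toℕ-mod a)) (≈-trans (≈-reflexive (cong toℕ p)) (toℕ-mod b))

  mod-toℕ : ∀ (i : Fin n) → toℕ i mod n ≡ i
  mod-toℕ i = toℕ-≈-injective (toℕ-mod (toℕ i))

  -- Colourings of ℤ/n that alternate under a translation.

  Periodic : (ℕ → Bool) → Set
  Periodic F = ∀ {a b} → a ≈ b → F a ≡ F b

  rotation : ℕ → Permutation n n
  rotation m = permutation (λ i → (toℕ i + m) mod n) (λ i → (toℕ i + m * (r + r)) mod n)
    (λ i → toℕ-≈-injective (begin
      toℕ ((toℕ ((toℕ i + m * (r + r)) mod n) + m) mod n) ≈⟨ toℕ-mod _ ⟩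
      toℕ ((toℕ i + m * (r + r)) mod n) + m ≈⟨ +-cong (toℕ-mod (toℕ i + m * (r + r))) ≈-refl ⟩
      toℕ i + m * (r + r) + m ≡⟨ back₁ (toℕ i) m (r + r) ⟩
      toℕ i + m * n ≈⟨ +n*≈ (toℕ i) m ⟩
      toℕ i ∎))
    (λ i → toℕ-≈-injective (begin
      toℕ ((toℕ ((toℕ i + m) mod n) + m * (r + r)) mod n) ≈⟨ toℕ-mod _ ⟩
      toℕ ((toℕ i + m) mod n) + m * (r + r) ≈⟨ +-cong (toℕ-mod (toℕ i + m)) ≈-refl ⟩
      toℕ i + m + m * (r + r) ≡⟨ back₂ (toℕ i) m (r + r) ⟩
      toℕ i + m * n ≈⟨ +n*≈ (toℕ i) m ⟩
      toℕ i ∎))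
    where
    back₁ : ∀ a m N → a + m * N + m ≡ a + m * suc N
    back₁ = solve-∀
    back₂ : ∀ a m N → a + m + m * N ≡ a + m * suc N
    back₂ = solve-∀

  sum-rotate : ∀ {F} → Periodic F → ∀ m →
               sum {n} (λ i → χ (F (toℕ i + m))) ≡ sum {n} (λ i → χ (F (toℕ i)))
  sum-rotate {F} per m = sym (trans (sum-permute (λ i → χ (F (toℕ i))) (rotation m))
    (sum-cong-≗ {n} (λ i → cong χ (per (toℕ-mod (toℕ i + m))))))

  -- Each pair `k`, `k + m` has exactly one coloured member, except the pair starting at `z`, which
  -- has none.
  record Alternating (m z : ℕ) (F : ℕ → Bool) : Set where
    field
      gap      : F z ≡ false
      gap+m    : F (z + m) ≡ false
      alternate : ∀ k → ¬ k ≈ z → F (k + m) ≡ not (F k)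

  -- Counting coloured members over all pairs `i`, `i + m` counts each coloured point twice. With at
  -- most one per pair, `S + S ≤ n`, so `S ≡ r` by parity, and the count `r + r` is one short of
  -- `n`: a single pair is empty.
  independent⇒alternating : ∀ {F} → Periodic F → ∀ m → r ≤ sum {n} (λ i → χ (F (toℕ i))) →
    (∀ (i : Fin n) → ¬ (F (toℕ i) ≡ true × F (toℕ i + m) ≡ true)) →
    ∃[ z ] Alternating m z F
  independent⇒alternating {F} per m r≤ indep = toℕ z , record
    { gap      = proj₁ (both-false (F (toℕ z)) _ gz)
    ; gap+m    = proj₂ (both-false (F (toℕ z)) _ gz)
    ; alternate = λ k k≉z → trans (per (+-cong (≈-sym (toℕ-mod k)) ≈-refl))
        (trans (one-true (F (toℕ (k mod n))) _ (others (k mod n)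
          (λ eq → k≉z (≈-trans (≈-sym (toℕ-mod k)) (≈-reflexive (cong toℕ eq))))))
          (cong not (per (toℕ-mod k)))) }
    where
    g : Fin n → ℕ
    g i = χ (F (toℕ i)) + χ (F (toℕ i + m))
    at-most-one : ∀ a b → ¬ (a ≡ true × b ≡ true) → χ a + χ b ≤ 1
    at-most-one true  true  h = contradiction (refl , refl) h
    at-most-one true  false h = ≤-refl
    at-most-one false b     h = χ≤1 b
    both-false : ∀ a b → χ a + χ b ≡ 0 → a ≡ false × b ≡ false
    both-false false false eq = refl , refl
    one-true : ∀ a b → χ a + χ b ≡ 1 → b ≡ not a
    one-true true  false eq = refl
    one-true false true  eq = refl
    S = sum {n} (λ i → χ (F (toℕ i)))
    sum-g : sum g ≡ S + S
    sum-g = trans (∑-distrib-+ {n} (λ i → χ (F (toℕ i))) (λ i → χ (F (toℕ i + m))))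
      (cong (S +_) (sum-rotate per m))
    g≤1 : ∀ i → g i ≤ 1
    g≤1 i = at-most-one _ _ (indep i)
    S≤r : S ≤ r
    S≤r = halve-≤-odd (≤-trans (≤-reflexive (sym sum-g)) (sum-≤-length g≤1))
    the-gap = unique-gap g g≤1 (cong suc (trans sum-g (cong (λ x → x + x) (≤-antisym S≤r r≤))))
    z = proj₁ the-gap
    gz = proj₁ (proj₂ the-gap)
    others = proj₂ (proj₂ the-gap)

  module _ {m z : ℕ} {F : ℕ → Bool} (per : Periodic F) (alt : Alternating m z F) where
    open Alternating alt

    -- An orbit of translation by m avoiding z would be alternately coloured by F
    -- and would close up after the odd number n of steps.
    reaches-gap : ∀ k → ∃[ j ] k + j * m ≈ z
    reaches-gap k with any? (λ (j : Fin n) → (k + toℕ j * m) ≈? z)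
    ... | yes (j , p) = toℕ j , p
    ... | no ¬p = contradiction
      (trans (cong not (sym (toggle-double r (F k)))) (trans (sym (walk n ≤-refl)) (per closed)))
      (λ eq → not-¬ {F k} refl (sym eq))
      where
      closed : k + n * m ≈ k
      closed = ≈-trans (≈-reflexive (cong (k +_) (*-comm n m))) (+n*≈ k m)
      walk : ∀ j → j ≤ n → F (k + j * m) ≡ toggle j (F k)
      walk zero    _   = cong F (+-identityʳ k)
      walk (suc j) j<n = trans (cong F (next-step k j m))
        (trans (alternate (k + j * m) (λ p → ¬p (Fin.fromℕ< j<n ,
          ≈-trans (≈-reflexive (cong (λ x → k + x * m) (toℕ-fromℕ< j<n))) p)))
          (cong not (walk j (<⇒≤ j<n))))
        where
        next-step : ∀ k j m → k + suc j * m ≡ (k + j * m) + m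
        next-step = solve-∀

  -- Both colourings are false at the common gap, which the orbit of `k` reaches after finitely many
  -- steps. Alternation carries the agreement back along the orbit to `k`.
  alternating-unique : ∀ {m z z′ F G} → Periodic F → Periodic G → z ≈ z′ →
    Alternating m z F → Alternating m z′ G → ∀ k → F k ≡ G k
  alternating-unique {m} {z} {z′} {F} {G} perF perG z≈z′ altF altG k with reaches-gap perF altF k
  ... | j , p = go j k p
    where
    at-gap : ∀ k → k ≈ z → F k ≡ G k
    at-gap k q = trans (perF q) (trans (Alternating.gap altF)
      (sym (trans (perG (≈-trans q z≈z′)) (Alternating.gap altG))))
    not-injective : ∀ {a b} → not a ≡ not b → a ≡ b
    not-injective {a} {b} eq = trans (sym (not-involutive a)) (trans (cong not eq) (not-involutive b))
    go : ∀ j k → k + j * m ≈ z → F k ≡ G k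
    go zero    k p = at-gap k (≈-trans (≈-reflexive (sym (+-identityʳ k))) p)
    -- The orbit may meet the gap before `j` runs out; alternation fails there, but agreement is
    -- immediate.
    go (suc j) k p with k ≈? z
    ... | yes q = at-gap k q
    ... | no k≉z = not-injective (trans (sym (Alternating.alternate altF k k≉z))
      (trans (go j (k + m) (≈-trans (≈-reflexive (+-assoc k m (j * m))) p))
        (Alternating.alternate altG k (λ q → k≉z (≈-trans q (≈-sym z≈z′))))))

  -- The orbit started at `z + 1` reaches `z`, so some multiple of `m` is -1. Reducing `j` modulo
  -- `n` keeps this true.
  step-unit : ∀ {m z F} → Periodic F → Alternating m z F → ∃[ j ] (j < n × 1 + j * m ≈ 0)
  step-unit {m} {z} per alt with reaches-gap per alt (z + 1)
  ... | j , p = j % n , m%n<n j n , ≈-trans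
    (+-cong ≈-refl (≈-trans (≈-reflexive (*-comm (j % n) m))
      (≈-trans (*-congˡ m (%≈ j)) (≈-reflexive (*-comm m j)))))
    (+-cancelˡ z (≈-trans (≈-reflexive (sym (+-assoc z 1 (j * m))))
      (≈-trans p (≈-reflexive (sym (+-identityʳ z))))))

  -- Multiples of a unit step and a pair of consecutive coloured points.

  module _ {m j : ℕ} (j<n : j < n) (unit : 1 + j * m ≈ 0) where

    -- As -j inverts `m`, multiplying `i * m ≈ 0` by `j` gives `i ≈ i * (1 + j * m) ≈ 0`.
    multiples-distinct : ∀ {i} → i < n → i * m ≈ 0 → i ≡ 0
    multiples-distinct {i} i<n im≈0 = ≈⇒≡ i<n (s≤s z≤n) (begin
      i                   ≡⟨ +-identityʳ i ⟨
      i + 0               ≡⟨ cong (i +_) (*-zeroʳ j) ⟨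
      i + j * 0           ≈⟨ +-cong ≈-refl (*-congˡ j im≈0) ⟨
      i + j * (i * m)     ≡⟨ rearr i j m ⟩
      i * (1 + j * m)     ≈⟨ *-congˡ i unit ⟩
      i * 0               ≡⟨ *-zeroʳ i ⟩
      0                   ∎)
      where
      rearr : ∀ i j m → i + j * (i * m) ≡ i * (1 + j * m)
      rearr = solve-∀

    -- Starting just after the gap, alternation applies at every step, because the multiples of `m`
    -- do not return to `z` in fewer than `n` steps.
    values : ∀ {z F} → Alternating m z F → ∀ i → suc i ≤ n → F (z + suc i * m) ≡ toggle i false
    values {z} {F} alt zero    _   = trans (cong (λ x → F (z + x)) (+-identityʳ m)) (Alternating.gap+m alt)
    values {z} {F} alt (suc i) i<n = trans (cong F (rearr z i m))
      (trans (Alternating.alternate alt (z + suc i * m) no-return)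
        (cong not (values alt i (<⇒≤ i<n))))
      where
      rearr : ∀ z i m → z + (2 + i) * m ≡ (z + suc i * m) + m
      rearr = solve-∀
      no-return : ¬ (z + suc i * m ≈ z)
      no-return p = contradiction
        (multiples-distinct i<n (+-cancelˡ z (≈-trans p (≈-reflexive (sym (+-identityʳ z)))))) λ ()

    value-even : ∀ {z F} → Alternating m z F → ∀ {a} → a < r → F (z + (2 + (a + a)) * m) ≡ true
    value-even alt {a} a<r = trans
      (values alt (suc (a + a)) (s≤s (≤-trans (s≤s (+-monoʳ-≤ a (n≤1+n a))) (+-mono-≤ a<r a<r))))
      (cong not (toggle-double a false))

    -- F holds at z + 2m, z + 4m, …, z + 2rm. As n is odd, one of ±1 is an even multiple
    -- 2tm with 0 < t ≤ r, and t ≠ r since m ≠ ±1, so z + 2m and z + (2 + 2t)m qualify.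
    consecutive-pair : 2 ≤ m → 2 + m ≤ n → ∃[ c ] (∀ {z F} → Periodic F → Alternating m z F →
      F (z + c) ≡ true × F (suc (z + c)) ≡ true)
    consecutive-pair 2≤m m+2≤n with even⊎odd j
    ... | a , inj₁ refl = (2 + (a + a)) * m , λ {z} {F} per alt → value-even alt a<r ,
        trans (per (begin
          suc (z + (2 + (a + a)) * m)              ≡⟨ rearr z (a + a) m ⟩
          z + 2 * m + (1 + (a + a) * m)            ≈⟨ +-cong ≈-refl unit ⟩
          z + 2 * m + 0                            ≡⟨ +-identityʳ _ ⟩
          z + 2 * m                                ∎))
          (value-even alt {0} (≤-trans (s≤s z≤n) a<r))
      where
      rearr : ∀ z j m → suc (z + (2 + j) * m) ≡ z + 2 * m + (1 + j * m)
      rearr = solve-∀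
      rearr′ : ∀ N m → 1 + suc N * m ≡ m + (1 + N * m)
      rearr′ = solve-∀
      a≢r : a ≢ r
      a≢r refl = <⇒≢ 2≤m (≈⇒≡ (≤-trans 2≤m (<⇒≤ (<⇒≤ m+2≤n))) (<⇒≤ m+2≤n) (begin
        1                     ≈⟨ +-cong (≈-refl {1}) (n*≈0 m) ⟨
        1 + n * m             ≡⟨ rearr′ (r + r) m ⟩
        m + (1 + (r + r) * m) ≈⟨ +-cong ≈-refl unit ⟩
        m + 0                 ≡⟨ +-identityʳ m ⟩
        m                     ∎))
      a<r : a < r
      a<r = ≤∧≢⇒< (halve-≤ (≤-pred j<n)) a≢r
    ... | a , inj₂ refl = 2 * m , λ {z} {F} per alt → value-even alt {0} (≤-trans (s≤s z≤n) b<r) ,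
        trans (per (begin
          suc (z + 2 * m)             ≡⟨ rearr z m ⟩
          z + 2 * m + 1               ≈⟨ +-cong (≈-refl {z + 2 * m}) 1≈bbm ⟩
          z + 2 * m + (b + b) * m     ≡⟨ rearr′ z (b + b) m ⟩
          z + (2 + (b + b)) * m       ∎))
          (value-even alt b<r)
      where
      -- Here `n` minus `j` is `b + b`, so `j * m ≈ −1` turns into `(b + b) * m ≈ 1`.
      b = r ∸ a
      a≤r : a ≤ r
      a≤r = halve-≤ (≤-pred (<⇒≤ j<n))
      a+b≡r : a + b ≡ r
      a+b≡r = m+[n∸m]≡n a≤r
      rearr : ∀ z m → suc (z + 2 * m) ≡ z + 2 * m + 1
      rearr = solve-∀
      rearr′ : ∀ z j m → z + 2 * m + j * m ≡ z + (2 + j) * m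
      rearr′ = solve-∀
      rearr″ : ∀ a b m → 1 + suc ((a + b) + (a + b)) * m ≡ (b + b) * m + (1 + suc (a + a) * m)
      rearr″ = solve-∀
      1≈bbm : 1 ≈ (b + b) * m
      1≈bbm = begin
        1                                      ≈⟨ +-cong (≈-refl {1}) (n*≈0 m) ⟨
        1 + n * m                              ≡⟨ cong (λ x → 1 + suc (x + x) * m) a+b≡r ⟨
        1 + suc ((a + b) + (a + b)) * m        ≡⟨ rearr″ a b m ⟩
        (b + b) * m + (1 + suc (a + a) * m)    ≈⟨ +-cong (≈-refl {(b + b) * m}) unit ⟩
        (b + b) * m + 0                        ≡⟨ +-identityʳ _ ⟩
        (b + b) * m                            ∎
      a≢0 : a ≢ 0
      a≢0 refl = contradiction
        (≈⇒≡ m+2≤n (s≤s z≤n) (≈-trans (≈-reflexive (cong suc (sym (+-identityʳ m)))) unit)) λ ()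
      b<r : b < r
      b<r = ≤-trans (+-monoˡ-≤ b (n≢0⇒n>0 a≢0)) (≤-reflexive a+b≡r)

-- Subset sizes as sums, and the successor of a cyclic index.

size≡sum : ∀ {k} (p : Subset k) → ∣ p ∣ ≡ sum (χ ∘ lookup p)
size≡sum []            = refl
size≡sum (inside  ∷ p) = cong suc (size≡sum p)
size≡sum (outside ∷ p) = size≡sum p

lookup-injective : ∀ {k} {p q : Subset k} → (∀ i → lookup p i ≡ lookup q i) → p ≡ q
lookup-injective {p = p} {q} eq =
  trans (sym (tabulate∘lookup p)) (trans (tabulate-cong eq) (tabulate∘lookup q))

sum-≤1 : ∀ {k} (h : Fin k → ℕ) → (∀ i → h i ≤ 1) →
         (∀ i j → i ≢ j → h i ≡ 1 → h j ≡ 1 → ⊥) → sum h ≤ 1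
sum-≤1 {zero}  h h≤1 _ = z≤n
sum-≤1 {suc k} h h≤1 excl with h zero in h₀ | h≤1 zero
... | 0 | _ = sum-≤1 (h ∘ suc) (h≤1 ∘ suc) (λ i j i≢j → excl (suc i) (suc j) (λ { refl → i≢j refl }))
... | 2+ _ | s≤s ()
... | 1 | _ = s≤s (≤-trans (sum-mono others) (≤-reflexive (trans (sum-const k 0) (*-zeroʳ k))))
  where
  others : ∀ i → h (suc i) ≤ 0
  others i with h (suc i) in hᵢ | h≤1 (suc i)
  ... | 0 | _ = z≤n
  ... | 1 | _ = contradiction (excl zero (suc i) (λ ()) h₀ hᵢ) λ ()
  ... | 2+ _ | s≤s ()

χ*χ≤1 : ∀ a b → χ a * χ b ≤ 1
χ*χ≤1 true  true  = ≤-refl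
χ*χ≤1 true  false = z≤n
χ*χ≤1 false b     = z≤n

χ*χ-true : ∀ {a b} → χ a * χ b ≡ 1 → a ≡ true × b ≡ true
χ*χ-true {true} {true} _ = refl , refl

next-inner : ∀ {m} (i : Fin (suc m)) → toℕ i < m → toℕ (next i) ≡ suc (toℕ i)
next-inner {m} i i<m = trans (toℕ-fromℕ< _) (m<n⇒m%n≡m (s≤s i<m))

next-last : ∀ {m} (i : Fin (suc m)) → toℕ i ≡ m → toℕ (next i) ≡ 0
next-last {m} i eq = trans (toℕ-fromℕ< _) (trans (cong (λ a → suc a % suc m) eq) (n%n≡0 (suc m)))

-- Double counting when no two edges share two vertices.

module _ {k} (r : ℕ) (3≤r : 3 ≤ r) (e : Fin k → Subset (suc (r + r))) where

  private
    n : ℕ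
    n = suc (r + r)

  degree : Fin n → ℕ
  degree v = ∑[ a < k ] χ (lookup (e a) v)

  -- The edges through v have sizes summing to at least r · degree v, while every
  -- vertex other than v is counted at most once in that sum.
  linear⇒degree≤3 : (∀ a → r ≤ ∣ e a ∣) →
    (∀ {a b v w} → a ≢ b → v ≢ w → v ∈ᵥ e a → w ∈ᵥ e a → v ∈ᵥ e b → ¬ w ∈ᵥ e b) →
    ∀ v → degree v ≤ 3
  linear⇒degree≤3 r≤ linear v = small (≤-trans lower upper)
    where
    A : Fin k → Fin n → ℕ
    A a w = χ (lookup (e a) w)
    codegree : Fin n → ℕ
    codegree w = ∑[ a < k ] (A a v * A a w)
    total : ℕ
    total = sum codegree
    total≡ : total ≡ ∑[ a < k ] (A a v * ∣ e a ∣)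
    total≡ = trans (∑-comm {n} {k} (λ w a → A a v * A a w)) (sum-cong-≗ {k} λ a →
      trans (sym (*-distribˡ-sum {n} (A a v) (A a))) (cong (A a v *_) (sym (size≡sum (e a)))))
    lower : r * degree v ≤ total
    lower = ≤-trans (≤-reflexive (*-distribˡ-sum {k} r (λ a → A a v)))
      (≤-trans
        (sum-mono (λ a → ≤-trans (≤-reflexive (*-comm r (A a v))) (*-monoʳ-≤ (A a v) (r≤ a))))
        (≤-reflexive (sym total≡)))
    codegree≤1 : ∀ w → w ≢ v → codegree w ≤ 1
    codegree≤1 w w≢v = sum-≤1 _ (λ a → χ*χ≤1 (lookup (e a) v) (lookup (e a) w)) λ a b a≢b p q →
      linear a≢b (w≢v ∘ sym)
        (lookup⇒[]= v (e a) (proj₁ (χ*χ-true p)))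
        (lookup⇒[]= w (e a) (proj₂ (χ*χ-true {lookup (e a) v} p)))
        (lookup⇒[]= v (e b) (proj₁ (χ*χ-true q)))
        (lookup⇒[]= w (e b) (proj₂ (χ*χ-true {lookup (e b) v} q)))
    codegree-v : codegree v ≤ degree v
    codegree-v = sum-mono λ a → idem (lookup (e a) v)
      where
      idem : ∀ b → χ b * χ b ≤ χ b
      idem true  = ≤-refl
      idem false = z≤n
    upper : total ≤ degree v + (r + r)
    upper = ≤-trans (≤-reflexive (sum-remove {r + r} {v} codegree))
      (+-mono-≤ codegree-v (sum-≤-length λ j → codegree≤1 (Fin.punchIn v j) (punchInᵢ≢i v j)))
    small : ∀ {d} → r * d ≤ d + (r + r) → d ≤ 3
    small {d} le with d ≤? 3
    ... | yes p = p
    ... | no d≰3 = contradiction (go 3≤r (≰⇒> d≰3) le) λ ()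
      -- With `r` = 3 + s and `d` = 4 + t, the left side exceeds the right by the positive last
      -- summand of `expand`.
      where
      expand : ∀ s t → (3 + s) * (4 + t) ≡ (4 + t + ((3 + s) + (3 + s))) + (2 + 2 * t + 2 * s + s * t)
      expand = solve-∀
      go : ∀ {r d} → 3 ≤ r → 4 ≤ d → r * d ≤ d + (r + r) → ⊥
      go (s≤s (s≤s (s≤s {n = s} z≤n))) (s≤s (s≤s (s≤s (s≤s {n = t} z≤n)))) le =
        m+1+n≰m _ (≤-trans (≤-reflexive (sym (expand s t))) le)

  -- Incidences counted by edges number at least `k * r`, and counted by vertices at most `n * 3`;
  -- already `suc n` edges would violate this when `r` is at least 3.
  linear⇒few-edges : (∀ a → r ≤ ∣ e a ∣) →
    (∀ {a b v w} → a ≢ b → v ≢ w → v ∈ᵥ e a → w ∈ᵥ e a → v ∈ᵥ e b → ¬ w ∈ᵥ e b) →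
    k ≤ n
  linear⇒few-edges r≤ linear = ≮⇒≥ λ n<k → go 3≤r (≤-trans (*-monoˡ-≤ r {suc n} {k} n<k) k*r≤)
    where
    k*r≤ : k * r ≤ n * 3
    k*r≤ = ≤-trans (≤-reflexive (sym (sum-const k r))) (≤-trans (sum-mono r≤)
      (≤-trans (≤-reflexive (trans (sum-cong-≗ {k} (λ a → size≡sum (e a)))
        (∑-comm {k} {n} (λ a v → χ (lookup (e a) v)))))
      (≤-trans (sum-mono (linear⇒degree≤3 r≤ linear)) (≤-reflexive (sum-const n 3)))))
    expand : ∀ s → suc (suc (3 + s + (3 + s))) * (3 + s) ≡
                   suc (3 + s + (3 + s)) * 3 + (3 + 8 * s + 2 * s * s)
    expand = solve-∀
    go : ∀ {r} → 3 ≤ r → ¬ (suc (suc (r + r)) * r ≤ suc (r + r) * 3)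
    go (s≤s (s≤s (s≤s {n = s} z≤n))) le = m+1+n≰m _ (≤-trans (≤-reflexive (sym (expand s))) le)

-- Berge cycles of length two.

two-cycle : ∀ {n} {H : Hypergraph n} {e e′ v w} → e ≢ e′ → v ≢ w → e ∈ edges H → e′ ∈ edges H →
  v ∈ᵥ e → w ∈ᵥ e → v ∈ᵥ e′ → w ∈ᵥ e′ → BergeCycle H 2
two-cycle {e = e} {e′} {v} {w} e≢e′ v≢w e∈ e′∈ v∈e w∈e v∈e′ w∈e′ = record
  { length≥2         = ≤-refl
  ; vertex           = λ { zero → v ; (suc zero) → w }
  ; edge             = λ { zero → e ; (suc zero) → e′ }
  ; vertex-injective = λ { {zero}     {zero}     _ → refl
                         ; {zero}     {suc zero} p → contradiction p v≢w
                         ; {suc zero} {zero}     p → contradiction (sym p) v≢w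
                         ; {suc zero} {suc zero} _ → refl }
  ; edge-injective   = λ { {zero}     {zero}     _ → refl
                         ; {zero}     {suc zero} p → contradiction p e≢e′
                         ; {suc zero} {zero}     p → contradiction (sym p) e≢e′
                         ; {suc zero} {suc zero} _ → refl }
  ; edge∈H           = λ { zero → e∈ ; (suc zero) → e′∈ }
  ; vertex∈edge      = λ { zero → v∈e ; (suc zero) → w∈e′ }
  ; next∈edge        = λ { zero → w∈e ; (suc zero) → v∈e′ }
  }

-- A Hamiltonian cycle with a spare edge.

module Exchange (r : ℕ) (H : Hypergraph (suc (r + r))) (V : Fin (suc (r + r)) → Fin (suc (r + r)))
  (V-injective : Injective _≡_ _≡_ V) (V-surjective : ∀ v → ∃ λ i → V i ≡ v) where

  open Cyclic r

  -- The vertex order `V` stays outside the record because exchanges only change which edge serves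
  -- at which position.
  record SpareEdgeCycle : Set where
    field
      E           : Fin n → Subset n
      f           : Subset n
      E-injective : Injective _≡_ _≡_ E
      f-spare     : ∀ i → E i ≢ f
      E∈H         : ∀ i → E i ∈ edges H
      f∈H         : f ∈ edges H
      V∈E         : ∀ i → V i ∈ᵥ E i
      next∈E      : ∀ i → V (next i) ∈ᵥ E i
      r≤E         : ∀ i → r ≤ ∣ E i ∣
      r≤f         : r ≤ ∣ f ∣

  open SpareEdgeCycle

  -- Membership read along the cycle and extended periodically to ℕ, so that an edge becomes a
  -- colouring of ℤ/n.
  trace : Subset n → ℕ → Bool
  trace p a = lookup p (V (a mod n))

  trace-periodic : ∀ p → Periodic (trace p)
  trace-periodic p eq = cong (lookup p ∘ V) (mod-cong eq)

  trace-injective : ∀ {p q} → (∀ a → trace p a ≡ trace q a) → p ≡ q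
  trace-injective {p} {q} eq = lookup-injective λ v → case v (V-surjective v)
    where
    case : ∀ v → (∃ λ i → V i ≡ v) → lookup p v ≡ lookup q v
    case v (i , refl) = trans (cong (lookup p ∘ V) (sym (mod-toℕ i)))
      (trans (eq (toℕ i)) (cong (lookup q ∘ V) (mod-toℕ i)))

  trace-size : ∀ p → ∣ p ∣ ≡ sum {n} (λ i → χ (trace p (toℕ i)))
  trace-size p = trans (size≡sum p) (trans (sum-permute (χ ∘ lookup p) π)
    (sum-cong-≗ {n} (λ i → cong (χ ∘ lookup p ∘ V) (sym (mod-toℕ i)))))
    where
    π : Permutation n n
    π = permutation V (proj₁ ∘ V-surjective) (λ v → proj₂ (V-surjective v))
      (λ i → V-injective (proj₂ (V-surjective (V i))))

  trace⇒∈ : ∀ {p} a → trace p a ≡ true → V (a mod n) ∈ᵥ p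
  trace⇒∈ {p} a = lookup⇒[]= (V (a mod n)) p

  suc-toℕ-mod : ∀ a → next (a mod n) ≡ suc a mod n
  suc-toℕ-mod a = mod-cong (+-cong (≈-refl {1}) (toℕ-mod a))

  -- The cycle runs through positions `a` to `a + m` along the edges of `E`, and `f` closes it from
  -- `a + m` back to `a`. So index `m` is the only one that uses `f`.
  chord-cycle : (s : SpareEdgeCycle) → ∀ {m} → 1 ≤ m → m < n → ∀ a →
    trace (f s) a ≡ true → trace (f s) (a + m) ≡ true → BergeCycle H (suc m)
  chord-cycle s {m} 1≤m m<n a fa fam = record
    { length≥2         = s≤s 1≤m
    ; vertex           = vertex
    ; edge             = edge
    ; vertex-injective = λ {i} {j} p → position-injective i j (V-injective p)
    ; edge-injective   = λ {i} {j} → edge-injective i j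
    ; edge∈H           = edge∈H
    ; vertex∈edge      = vertex∈edge
    ; next∈edge        = next∈edge
    }
    where
    position : Fin (suc m) → Fin n
    position i = (a + toℕ i) mod n
    vertex : Fin (suc m) → Fin n
    vertex = V ∘ position
    edge : Fin (suc m) → Subset n
    edge i with toℕ i <? m
    ... | yes _ = E s (position i)
    ... | no  _ = f s
    position-injective : ∀ i j → position i ≡ position j → i ≡ j
    position-injective i j p = toℕ-injective (≈⇒≡ (≤-trans (toℕ<n i) m<n) (≤-trans (toℕ<n j) m<n)
      (+-cancelˡ a (mod-injective p)))
    last : ∀ i → ¬ toℕ i < m → toℕ {suc m} i ≡ m
    last i i≮m = ≤-antisym (≤-pred (toℕ<n i)) (≮⇒≥ i≮m)
    edge-injective : ∀ i j → edge i ≡ edge j → i ≡ j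
    edge-injective i j p with toℕ i <? m | toℕ j <? m
    ... | yes _   | yes _   = position-injective i j (E-injective s p)
    ... | yes _   | no  _   = contradiction p (f-spare s _)
    ... | no  _   | yes _   = contradiction (sym p) (f-spare s _)
    ... | no  i≮m | no  j≮m = toℕ-injective (trans (last i i≮m) (sym (last j j≮m)))
    edge∈H : ∀ i → edge i ∈ edges H
    edge∈H i with toℕ i <? m
    ... | yes _ = E∈H s _
    ... | no  _ = f∈H s
    vertex∈edge : ∀ i → vertex i ∈ᵥ edge i
    vertex∈edge i with toℕ i <? m
    ... | yes _   = V∈E s _
    ... | no  i≮m = trace⇒∈ (a + toℕ i) (subst (λ x → trace (f s) (a + x) ≡ true) (sym (last i i≮m)) fam)
    next∈edge : ∀ i → vertex (next i) ∈ᵥ edge i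
    next∈edge i with toℕ i <? m
    ... | yes i<m = subst (λ x → V x ∈ᵥ E s (position i))
      (trans (suc-toℕ-mod (a + toℕ i))
        (cong (_mod n) (sym (trans (cong (a +_) (next-inner i i<m)) (+-suc a (toℕ i))))))
      (next∈E s (position i))
    ... | no  i≮m = trace⇒∈ (a + toℕ (next i)) (subst (λ x → trace (f s) x ≡ true)
      (sym (trans (cong (a +_) (next-last i (last i i≮m))) (+-identityʳ a))) fa)

  cycle⊎alternating : (s : SpareEdgeCycle) → ∀ {m} → 1 ≤ m → m < n →
    BergeCycle H (suc m) ⊎ ∃[ z ] Alternating m z (trace (f s))
  cycle⊎alternating s {m} 1≤m m<n
    with any? (λ (i : Fin n) → (trace (f s) (toℕ i) ≟ᵇ true) ×-dec
                               (trace (f s) (toℕ i + m) ≟ᵇ true))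
  ... | yes (i , p , q) = inj₁ (chord-cycle s 1≤m m<n (toℕ i) p q)
  ... | no ¬p = inj₂ (independent⇒alternating (trace-periodic (f s)) m
    (≤-trans (r≤f s) (≤-reflexive (trace-size (f s)))) λ i h → ¬p (i , h))

  -- `f` contains both ends of the step at `x`, so it can serve there, and the displaced `E s x` is
  -- distinct from all edges now in use.
  exchange : (s : SpareEdgeCycle) (x : Fin n) → V x ∈ᵥ f s → V (next x) ∈ᵥ f s → SpareEdgeCycle
  exchange s x Vx∈f next∈f = record
    { E           = E′
    ; f           = E s x
    ; E-injective = λ {i} {j} → E′-injective i j
    ; f-spare     = spare
    ; E∈H         = on-E′ (_∈ edges H) (f∈H s) (E∈H s)
    ; f∈H         = E∈H s x
    ; V∈E         = λ i → on-E′-at (λ i p → V i ∈ᵥ p) Vx∈f (V∈E s) i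
    ; next∈E      = λ i → on-E′-at (λ i p → V (next i) ∈ᵥ p) next∈f (next∈E s) i
    ; r≤E         = on-E′ (λ p → r ≤ ∣ p ∣) (r≤f s) (r≤E s)
    ; r≤f         = r≤E s x
    }
    where
    E′ : Fin n → Subset n
    E′ = updateAt (E s) x (const (f s))
    on-E′-at : (P : Fin n → Subset n → Set) → P x (f s) → (∀ i → P i (E s i)) → ∀ i → P i (E′ i)
    on-E′-at P Pf PE i with i Fin.≟ x
    ... | yes refl = subst (P x) (sym (updateAt-updates x (E s))) Pf
    ... | no i≢x   = subst (P i) (sym (updateAt-minimal i x (E s) i≢x)) (PE i)
    on-E′ : (P : Subset n → Set) → P (f s) → (∀ i → P (E s i)) → ∀ i → P (E′ i)
    on-E′ P = on-E′-at (λ _ → P)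
    spare : ∀ i → E′ i ≢ E s x
    spare i with i Fin.≟ x
    ... | yes refl = subst (_≢ E s x) (sym (updateAt-updates x (E s))) (f-spare s x ∘ sym)
    ... | no i≢x   = subst (_≢ E s x) (sym (updateAt-minimal i x (E s) i≢x)) (i≢x ∘ E-injective s)
    E′-injective : ∀ i j → E′ i ≡ E′ j → i ≡ j
    E′-injective i j p with i Fin.≟ x | j Fin.≟ x
    ... | yes refl | yes refl = refl
    ... | yes refl | no j≢x   = contradiction
      (trans (sym (updateAt-minimal j x (E s) j≢x)) (trans (sym p) (updateAt-updates x (E s))))
      (f-spare s j)
    ... | no i≢x   | yes refl = contradiction
      (trans (sym (updateAt-minimal i x (E s) i≢x)) (trans p (updateAt-updates x (E s))))
      (f-spare s i)
    ... | no i≢x   | no j≢x   = E-injective s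
      (trans (sym (updateAt-minimal i x (E s) i≢x)) (trans p (updateAt-minimal j x (E s) j≢x)))

  -- Repeated exchange for a fixed length.

  module _ {m c : ℕ} (1≤m : 1 ≤ m) (m<n : m < n)
    (pair : ∀ {z F} → Periodic F → Alternating m z F → F (z + c) ≡ true × F (suc (z + c)) ≡ true) where

    -- The edge at `x` has the very trace that would send a spare edge to position `x`.
    Settled : SpareEdgeCycle → Fin n → Set
    Settled s x = ∃[ z ] (Alternating m z (trace (E s x)) × (z + c) mod n ≡ x)

    Progress : ℕ → Set
    Progress k = ∃[ s ] ∃[ xs ] (Injective {A = Fin k} _≡_ _≡_ xs × (∀ i → Settled s (xs i)))

    settle : ∀ {k} → Progress k → BergeCycle H (suc m) ⊎ Progress (suc k)
    settle {k} (s , xs , xs-injective , settled) with cycle⊎alternating s 1≤m m<n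
    ... | inj₁ C = inj₁ C
    ... | inj₂ (z , alt) = inj₂ (s′ , x F.∷ xs , xs′-injective , settled′)
      where
      x : Fin n
      x = (z + c) mod n
      pairs : trace (f s) (z + c) ≡ true × trace (f s) (suc (z + c)) ≡ true
      pairs = pair (trace-periodic (f s)) alt
      s′ : SpareEdgeCycle
      s′ = exchange s x (trace⇒∈ (z + c) (proj₁ pairs))
        (subst (λ y → V y ∈ᵥ f s) (sym (suc-toℕ-mod (z + c))) (trace⇒∈ (suc (z + c)) (proj₂ pairs)))
      -- Were `x` settled, the edge there and the spare edge would alternate with the same gap
      -- modulo `n`, hence coincide.
      unsettled : ¬ Settled s x
      unsettled (z′ , alt′ , eq) = f-spare s x (trace-injective
        (alternating-unique (trace-periodic (E s x)) (trace-periodic (f s))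
          (+-cancelʳ c (mod-injective eq)) alt′ alt))
      xs≢x : ∀ i → xs i ≢ x
      xs≢x i eq = unsettled (subst (Settled s) eq (settled i))
      xs′-injective : Injective _≡_ _≡_ (x F.∷ xs)
      xs′-injective {zero}  {zero}  _ = refl
      xs′-injective {zero}  {suc j} p = contradiction (sym p) (xs≢x j)
      xs′-injective {suc i} {zero}  p = contradiction p (xs≢x i)
      xs′-injective {suc i} {suc j} p = cong suc (xs-injective p)
      settled′ : ∀ i → Settled s′ ((x F.∷ xs) i)
      settled′ zero    = z , subst (Alternating m z ∘ trace) (sym (updateAt-updates x (E s))) alt , refl
      settled′ (suc i) with z′ , alt′ , eq ← settled i =
        -- Earlier settled positions differ from `x`, so the exchange leaves their edges untouched.
        z′ , subst (Alternating m z′ ∘ trace) (sym (updateAt-minimal (xs i) x (E s) (xs≢x i))) alt′ , eq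

    cycle⊎progress : SpareEdgeCycle → ∀ k → BergeCycle H (suc m) ⊎ Progress k
    cycle⊎progress s zero    = inj₂ (s , (λ ()) , (λ { {()} }) , λ ())
    cycle⊎progress s (suc k) with cycle⊎progress s k
    ... | inj₁ C = inj₁ C
    ... | inj₂ p = settle p

    cycle : SpareEdgeCycle → BergeCycle H (suc m)
    -- `suc n` distinct settled positions cannot fit among `n`.
    cycle s with cycle⊎progress s (suc n)
    ... | inj₁ C = C
    ... | inj₂ (_ , _ , xs-injective , _) = contradiction (injective⇒≤ xs-injective) 1+n≰n

  -- Intermediate lengths and length two.

  middle-cycle : SpareEdgeCycle → ∀ {m} → 2 ≤ m → 2 + m ≤ n → BergeCycle H (suc m)
  middle-cycle s {m} 2≤m m+2≤n with cycle⊎alternating s (<⇒≤ 2≤m) (<⇒≤ m+2≤n)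
  ... | inj₁ C = C
  -- This first alternating trace serves to show that `m` is a unit. The resulting `c` works for
  -- every alternating colouring, hence for every later spare edge.
  ... | inj₂ (z , alt) with j , j<n , unit ← step-unit (trace-periodic (f s)) alt
    with c , pair ← consecutive-pair j<n unit 2≤m m+2≤n = cycle (<⇒≤ 2≤m) (<⇒≤ m+2≤n) pair s

  short-cycle : 3 ≤ r → SpareEdgeCycle → BergeCycle H 2
  short-cycle 3≤r s = by (any? λ a → any? λ b → any? λ v → any? λ w →
    ¬? (a Fin.≟ b) ×-dec ¬? (v Fin.≟ w) ×-dec
    (v ∈ᵥ? e a) ×-dec (w ∈ᵥ? e a) ×-dec (v ∈ᵥ? e b) ×-dec (w ∈ᵥ? e b))
    where
    e : Fin (suc n) → Subset n
    e = f s F.∷ E s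
    e-injective : Injective _≡_ _≡_ e
    e-injective {zero}  {zero}  _ = refl
    e-injective {zero}  {suc j} p = contradiction (sym p) (f-spare s j)
    e-injective {suc i} {zero}  p = contradiction p (f-spare s i)
    e-injective {suc i} {suc j} p = cong suc (E-injective s p)
    e∈H : ∀ a → e a ∈ edges H
    e∈H zero    = f∈H s
    e∈H (suc i) = E∈H s i
    r≤e : ∀ a → r ≤ ∣ e a ∣
    r≤e zero    = r≤f s
    r≤e (suc i) = r≤E s i
    by : Dec (∃[ a ] ∃[ b ] ∃[ v ] ∃[ w ]
           (a ≢ b × v ≢ w × v ∈ᵥ e a × w ∈ᵥ e a × v ∈ᵥ e b × w ∈ᵥ e b)) →
         BergeCycle H 2
    by (yes (a , b , v , w , a≢b , v≢w , va , wa , vb , wb)) =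
      two-cycle (a≢b ∘ e-injective) v≢w (e∈H a) (e∈H b) va wa vb wb
    by (no ¬p) = contradiction
      (linear⇒few-edges r 3≤r e r≤e λ a≢b v≢w va wa vb wb →
        ¬p (_ , _ , _ , _ , a≢b , v≢w , va , wa , vb , wb))
      1+n≰n

-- Assembly of all lengths.

spanning-length : ∀ {n ℓ} {H : Hypergraph n} (C : BergeCycle H ℓ) → Hamiltonian C → ℓ ≡ n
spanning-length C ham = ≤-antisym (injective⇒≤ (BergeCycle.vertex-injective C))
  (injective⇒≤ {f = proj₁ ∘ ham} λ {v} {w} p →
    trans (sym (proj₂ (ham v))) (trans (cong (BergeCycle.vertex C) p) (proj₂ (ham w))))

-- `H` may be any hypergraph containing the cycle and `f`, so this covers both the hypergraph formed
-- by just these edges and the full uniform one.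
pancyclic : ∀ {n r} → n ≡ suc (r + r) → 3 ≤ r →
  (H : Hypergraph n) {ℓ : ℕ} (C : BergeCycle H ℓ) → Hamiltonian C →
  (∀ i → r ≤ ∣ BergeCycle.edge C i ∣) →
  (f : Subset n) → f ∈ edges H → (∀ i → BergeCycle.edge C i ≢ f) → r ≤ ∣ f ∣ → BergePancyclic H
pancyclic {r = r} refl 3≤r H C ham r≤E f f∈H f-spare r≤f with refl ← spanning-length C ham = by
  where
  open BergeCycle C
    using (vertex; edge; vertex-injective; edge-injective; edge∈H; vertex∈edge; next∈edge)
  open Exchange r H vertex vertex-injective ham
  s : SpareEdgeCycle
  s = record
    { E = edge ; f = f ; E-injective = edge-injective ; f-spare = f-spare ; E∈H = edge∈H ; f∈H = f∈H
    ; V∈E = vertex∈edge ; next∈E = next∈edge ; r≤E = r≤E ; r≤f = r≤f }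
  by : ∀ ℓ → 2 ≤ ℓ → ℓ ≤ suc (r + r) → BergeCycle H ℓ
  by (suc zero) (s≤s ()) _
  by (suc (suc zero)) _ _ = short-cycle 3≤r s
  by (suc (suc (suc ℓ))) _ ℓ≤n with 3 + ℓ ≟ suc (r + r)
  ... | yes eq = subst (BergeCycle H) (sym eq) C
  -- With the length written as `suc m`, `m` lies between 2 and `n` minus 2, which excludes steps
  -- ±1.
  ... | no ℓ≢n   = middle-cycle s (s≤s (s≤s z≤n)) (≤∧≢⇒< ℓ≤n ℓ≢n)

corollary1p4 : (n r : ℕ) → n ≡ 2 * r + 1 → 7 ≤ n →
    ((H : Hypergraph n) (ℓ : ℕ) (C : BergeCycle H ℓ) → Hamiltonian C →
    (∀ e → e ∈ edgeSet C → r ≤ ∣ e ∣) →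
    (f : Subset n) → f ∈ edges H → (f∉C : f ∉ edgeSet C) → r ≤ ∣ f ∣ →
    BergePancyclic (cyclePlusEdge C f f∉C))
    ×
    ((H : Hypergraph n) → Uniform r H →
    (ℓ : ℕ) (C : BergeCycle H ℓ) → Hamiltonian C →
    (∃[ f ] (f ∈ edges H × f ∉ edgeSet C)) →
    BergePancyclic H)
corollary1p4 n r n≡2r+1 7≤n = general , uniform
  where
  n≡ : n ≡ suc (r + r)
  n≡ = trans n≡2r+1 (rearr r)
    where
    rearr : ∀ r → 2 * r + 1 ≡ suc (r + r)
    rearr = solve-∀
  3≤r : 3 ≤ r
  3≤r = halve-≤ (≤-pred (subst (7 ≤_) n≡ 7≤n))
  edge∈C : ∀ {H : Hypergraph n} {ℓ} (C : BergeCycle H ℓ) i → BergeCycle.edge C i ∈ edgeSet C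
  edge∈C C = ∈-tabulate⁺
  general : _
  general H ℓ C ham r≤ f _ f∉C r≤f = pancyclic n≡ 3≤r (cyclePlusEdge C f f∉C)
    -- The same cycle, re-read inside the hypergraph consisting of its own edges and `f`.
    record { length≥2 = length≥2 ; vertex = vertex ; edge = edge
           ; vertex-injective = vertex-injective ; edge-injective = edge-injective
           ; edge∈H = λ i → there (edge∈C C i)
           ; vertex∈edge = vertex∈edge ; next∈edge = next∈edge }
    ham (λ i → r≤ _ (edge∈C C i)) f (here refl) (λ { i refl → f∉C (edge∈C C i) }) r≤f
    where open BergeCycle C
  uniform : _
  uniform H unif ℓ C ham (f , f∈H , f∉C) = pancyclic n≡ 3≤r H C ham
    (λ i → ≤-reflexive (sym (unif _ (BergeCycle.edge∈H C i)))) f f∈H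
    (λ { i refl → f∉C (edge∈C C i) }) (≤-reflexive (sym (unif f f∈H)))
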